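{- The robust maximum flow over time problem is at least as hard as the static robust maximum flow problem: the static robust maximum flow problem is polynomial-time reducible to the robust maximum flow over time problem.
   Context: $\mathbb N$ contains $0$. Robust maximum flow over time problem. An instance consists of a finite directed graph $G=(V,E)$ (parallel edges allowed), a source $s\in V$ and a destination $d\in V$, where $d$ has no outgoing edges, capacities $u:E\to\mathbb N$, travel times $\tau:E\to\mathbb N$, delays $\Delta:E\to\mathbb N$, a time horizon $T\in\mathbb N$, $T\ge 1$, and an integer $\Gamma\in\mathbb N$. Let $\mathcal P$ be the set of simple $s$-$d$-paths and $\mathcal S=\{z\in\{0,1\}^{E}:\sum_{e\in E}z_e\le\Gamma\}$ the set of scenarios. For $P\in\mathcal P$ put $\tau(P)=\sum_{e\in P}\tau_e$ and $\Delta_z(P)=\sum_{e\in P}\Delta_e z_e$. For $e\in P$, write $e'<_P e$ if $e'$ is an edge of $P$ traversed before $e$. A solution is a family of triples $\{(P^i,f^i,[a^i,b^i))\}_{i=1,\dots,\omega}$ with $P^i\in\mathcal P$, $f^i>0$, $a^i,b^i\in\{0,\dots,T\}$, $a^i<b^i$ (flow is sent into $P^i$ at rate $f^i$ during $[a^i,b^i)$), inducing $f_P(\theta)=\sum_{i:\,P^i=P,\ \theta\in[a^i,b^i)}f^i$. It is feasible if $$\sum_{P\in\mathcal P:\,e\in P}f_P\Big(\theta-\sum_{e'<_P e}(\tau_{e'}+\Delta_{e'}z_{e'})\Big)\le u_e\qquad\text{for all }e\in E,\ \theta\in[0,T),\ z\in\mathcal S,$$ and its robust value is $\min_{z\in\mathcal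 S}\sum_{P\in\mathcal P}\int_0^{\max\{0,\,T-\tau(P)-\Delta_z(P)\}}f_P(\nu)\,d\nu$. The task is to find a feasible solution of maximum robust value. Static robust maximum flow problem. An instance consists of a directed graph $G=(V,E)$, vertices $s,d$, where $d$ has no outgoing edges, capacities $u:E\to\mathbb N$ and $\Gamma\in\mathbb N$. The task is to find $x_P\ge0$ for the simple $s$-$d$-paths $P$ with $\sum_{P\ni e}x_P\le u_e$ for all $e\in E$, maximizing $\min_{F\subseteq E,\ |F|\le\Gamma}\ \sum_{P:\,P\cap F=\emptyset}x_P$ (the flow surviving the failure of at most $\Gamma$ edges, without rerouting).
   Formalization: Path flow amounts x_P, flow rates f^i, the times θ and the objective thresholds are rational numbers instead of real numbers, so feasible and optimal solutions of both problems range over rational solutions. -}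

module Defs where

open import Data.Bool using (if_then_else_)
open import Data.Digit using (toDigits)
open import Data.Fin using (Fin; zero; suc; toℕ)
import Data.Fin as Fin
import Data.Fin.Properties as Fin
open import Data.Fin.Subset using (Subset; inside; outside; ∣_∣; _∉_) renaming (⊥ to ∅)
open import Data.Fin.Subset.Properties using () renaming (_∈?_ to _∈ₛ?_)
open import Data.Integer using (ℤ; +_; -[1+_])
open import Data.List using (List; []; _∷_; [_]; _++_; map; foldr; filter; concatMap; cartesianProductWith;
  allFin; upTo; length; replicate; reverse; takeWhile)
import Data.List.Extrema as Extrema
import Data.List.Membership.DecPropositional as DecMembership
open import Data.List.Properties using (≡-dec)
open import Data.List.Relation.Unary.All using (All; all?)
open import Data.List.Relation.Unary.Unique.Propositional using (Unique)
import Data.List.Relation.Unary.Unique.DecPropositional as DecUnique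
open import Data.Maybe using (Maybe; just; nothing)
open import Data.Nat using (ℕ; zero; suc; _+_; _*_; _^_; _∸_; _≤_; _<_; _≤?_)
open import Data.Nat.ListAction using (sum)
open import Data.Product using (Σ; ∃₂; ∃-syntax; _×_; _,_; proj₁; proj₂)
open import Data.Rational using (ℚ; 0ℚ; _/_; ↥_; ↧ₙ_) renaming (_+_ to _+ℚ_; _-_ to _-ℚ_;
  _≤_ to _≤ℚ_; _<_ to _<ℚ_; _≤?_ to _≤ℚ?_; _<?_ to _<ℚ?_)
import Data.Rational.Properties as ℚ
open import Data.Vec as Vec using (Vec; _∷_; lookup)
open import Function using (_∘_; _⇔_)
open import Relation.Binary.Bundles using (DecTotalOrder)
open import Relation.Binary.PropositionalEquality using (_≡_; _≢_)
open import Relation.Nullary using (Dec; ¬?; _×-dec_)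
open import Relation.Unary using (Decidable)

data Sym : Set where
  bit                          : Fin 2 → Sym
  comma semi bar minus pairSep : Sym

Word : Set
Word = List Sym

data TapeSym (a : ℕ) : Set where
  blank : TapeSym a
  sym   : Sym → TapeSym a
  aux   : Fin a → TapeSym a

data Move : Set where
  left stay right : Move

-- Tape 0 carries the input, tape 1 the output; the others are work tapes.
-- The machine halts when the transition function returns nothing.
record Machine : Set where
  field
    states auxSyms workTapes : ℕ
  tapes : ℕ
  tapes = 2 + workTapes
  field
    start : Fin states
    δ     : Fin states → Vec (TapeSym auxSyms) tapes →
            Maybe (Fin states × Vec (TapeSym auxSyms × Move) tapes)

-- A two-way infinite tape.  The cells to the left of the head are listed
-- from right to left; every cell not listed is blank.
record Tape (a : ℕ) : Set where
  constructor tape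
  field
    before : List (TapeSym a)
    head   : TapeSym a
    after  : List (TapeSym a)

module _ {a : ℕ} where

  move : Move → Tape a → Tape a
  move stay  t                     = t
  move left  (tape []       h rs)  = tape [] blank (h ∷ rs)
  move left  (tape (l ∷ ls) h rs)  = tape ls l (h ∷ rs)
  move right (tape ls h [])        = tape (h ∷ ls) blank []
  move right (tape ls h (r ∷ rs))  = tape (h ∷ ls) r rs

  write : TapeSym a × Move → Tape a → Tape a
  write (x , m) (tape ls _ rs) = move m (tape ls x rs)

  emptyTape : Tape a
  emptyTape = tape [] blank []

  wordTape : Word → Tape a
  wordTape []      = emptyTape
  wordTape (x ∷ w) = tape [] (sym x) (map sym w)

  -- The tape contains w and is blank elsewhere, wherever the head is.
  Contains : Tape a → Word → Set
  Contains (tape ls h rs) w = ∃₂ λ i j →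
    reverse ls ++ h ∷ rs ≡ replicate i blank ++ map sym w ++ replicate j blank

module _ (M : Machine) where
  open Machine M

  Config : Set
  Config = Fin states × Vec (Tape auxSyms) tapes

  initial : Word → Config
  initial w = start , wordTape w ∷ Vec.replicate _ emptyTape

  step : Config → Maybe Config
  step (q , ts) with δ q (Vec.map Tape.head ts)
  ... | nothing         = nothing
  ... | just (q′ , acts) = just (q′ , Vec.zipWith write acts ts)

  data _⇓[_]_ : Config → ℕ → Config → Set where
    halt : ∀ {c} → step c ≡ nothing → c ⇓[ 0 ] c
    next : ∀ {c c′ c″ t} → step c ≡ just c′ → c′ ⇓[ t ] c″ → c ⇓[ suc t ] c″

  OutputsIn : ℕ → Word → Word → Set
  OutputsIn t w v = ∃[ c ] (initial w ⇓[ t ] c) × Contains (lookup (proj₂ c) (suc zero)) v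

-- A single machine turns the word  input x  into the word  output x  in
-- time polynomial in the length of  input x , for every x.
record PolyTime {X : Set} (input output : X → Word) : Set where
  field
    machine  : Machine
    c k      : ℕ
    computes : ∀ x → ∃[ t ] t ≤ c * length (input x) ^ k + c ×
                            OutputsIn machine t (input x) (output x)

-- Solutions are objects to be computed from discrete data, so objective
-- values (and flow values below) are rational.  For linear programs with
-- integral data this loses nothing: optima are attained at rational points.
record MaxProblem : Set₁ where
  field
    Instance       : Set
    Solution       : Instance → Set
    Feasible       : ∀ I → Solution I → Set
    value          : ∀ I → Solution I → ℚ
    encodeInstance : Instance → Word
    encodeSolution : ∀ I → Solution I → Word

  AtLeast : Instance → ℚ → Set
  AtLeast I K = ∃[ S ] Feasible I S × K ≤ℚ value I S

  Optimal : ∀ I → Solution I → Set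
  Optimal I S = Feasible I S × (∀ S′ → Feasible I S′ → value I S′ ≤ℚ value I S)

-- f reduces the decision version of A to that of B, and (f , g) reduces the
-- task of finding an optimal solution of A to the same task for B.  The
-- field threshold also makes f I have an optimal solution when I has one.
record _≤ᵖ_ (A B : MaxProblem) : Set where
  private
    module A = MaxProblem A
    module B = MaxProblem B
  field
    f          : A.Instance → B.Instance
    f-polytime : PolyTime A.encodeInstance (B.encodeInstance ∘ f)
    threshold  : ∀ I K → A.AtLeast I K ⇔ B.AtLeast (f I) K
    g          : ∀ I → B.Solution (f I) → A.Solution I
    g-polytime : PolyTime {Σ A.Instance (B.Solution ∘ f)}
                   (λ (I , S) → A.encodeInstance I ++ pairSep ∷ B.encodeSolution (f I) S)
                   (λ (I , S) → A.encodeSolution I (g I S))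
    optimal    : ∀ I S → B.Optimal (f I) S → A.Optimal I (g I S)

fromℕ : ℕ → ℚ
fromℕ n = + n / 1

∑ : {A : Set} → List A → (A → ℚ) → ℚ
∑ xs h = foldr _+ℚ_ 0ℚ (map h xs)

subsets : ∀ m → List (Subset m)
subsets zero    = [ Vec.[] ]
subsets (suc m) = cartesianProductWith _∷_ (outside ∷ inside ∷ []) (subsets m)

subsetsUpTo : ∀ m → ℕ → List (Subset m)
subsetsUpTo m Γ = filter (λ F → ∣ F ∣ ≤? Γ) (subsets m)

-- The empty set is one of the subsets of size at most Γ, so taking h ∅ as
-- the default value does not change the minimum.
minUpTo : ∀ {m} → ℕ → (Subset m → ℚ) → ℚ
minUpTo {m} Γ h = Extrema.min (DecTotalOrder.totalOrder ℚ.≤-decTotalOrder)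
                              (h ∅) (map h (subsetsUpTo m Γ))

record Network : Set where
  field
    n m         : ℕ
    tail head   : Fin m → Fin n
    source sink : Fin n
    capacity    : Fin m → ℕ
    sink-no-out : ∀ e → tail e ≢ sink

  Edge : Set
  Edge = Fin m

  Walk : Fin n → List Edge → Fin n → Set
  Walk v []      w = v ≡ w
  Walk v (e ∷ P) w = tail e ≡ v × Walk (head e) P w

  walk? : ∀ v P w → Dec (Walk v P w)
  walk? v []      w = v Fin.≟ w
  walk? v (e ∷ P) w = (tail e Fin.≟ v) ×-dec walk? (head e) P w

  SimplePath : List Edge → Set
  SimplePath P = Walk source P sink × Unique (source ∷ map head P)

  simplePath? : Decidable SimplePath
  simplePath? P = walk? source P sink ×-dec DecUnique.unique? Fin._≟_ (source ∷ map head P)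

  edgeLists : ℕ → List (List Edge)
  edgeLists zero    = [ [] ]
  edgeLists (suc l) = [] ∷ cartesianProductWith _∷_ (allFin m) (edgeLists l)

  -- All simple source-sink paths, each listed once: a simple path has fewer
  -- than n edges.
  𝒫 : List (List Edge)
  𝒫 = filter simplePath? (edgeLists n)

  open DecMembership (Fin._≟_ {m}) public using () renaming (_∈_ to _∈ₚ_; _∈?_ to _∈ₚ?_)

  _≟ₚ_ : (P Q : List Edge) → Dec (P ≡ Q)
  _≟ₚ_ = ≡-dec Fin._≟_

  pathsThrough : Edge → List (List Edge)
  pathsThrough e = filter (e ∈ₚ?_) 𝒫

-- Binary, least significant digit first.
encodeℕ : ℕ → Word
encodeℕ k = map bit (proj₁ (toDigits 2 k)) ++ [ comma ]

encodeFin : ∀ {k} → Fin k → Word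
encodeFin = encodeℕ ∘ toℕ

encodeℤ : ℤ → Word
encodeℤ (+ k)    = encodeℕ k
encodeℤ -[1+ k ] = minus ∷ encodeℕ (suc k)

encodeℚ : ℚ → Word
encodeℚ q = encodeℤ (↥ q) ++ encodeℕ (↧ₙ q)

encodePath : ∀ {m} → List (Fin m) → Word
encodePath P = concatMap encodeFin P ++ [ bar ]

record StaticInstance : Set where
  field
    network : Network
    Γ       : ℕ
  open Network network public

record PathFlow (m : ℕ) : Set where
  field
    path   : List (Fin m)
    amount : ℚ

module Static (I : StaticInstance) where
  open StaticInstance I

  -- The family (x_P), given sparsely: several entries for the same path add up.
  Solution : Set
  Solution = List (PathFlow m)

  survives? : (F : Subset m) → Decidable (All (_∉ F))
  survives? F = all? (λ e → ¬? (e ∈ₛ? F))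

  module _ (X : Solution) where

    x : List Edge → ℚ
    x P = ∑ (filter (λ i → PathFlow.path i ≟ₚ P) X) PathFlow.amount

    record Feasible : Set where
      field
        entries    : All (λ i → SimplePath (PathFlow.path i) × 0ℚ ≤ℚ PathFlow.amount i) X
        capacities : ∀ e → ∑ (pathsThrough e) x ≤ℚ fromℕ (capacity e)

    value : ℚ
    value = minUpTo Γ (λ F → ∑ (filter (survives? F) 𝒫) x)

  encodeInstance : Word
  encodeInstance =
    encodeFin source ++ encodeFin sink ++ encodeℕ Γ ++ semi ∷
    concatMap encodeFin (allFin n) ++ semi ∷
    concatMap (λ e → encodeFin (tail e) ++ encodeFin (head e) ++ encodeℕ (capacity e) ++ [ semi ])
              (allFin m)

  encodeSolution : Solution → Word
  encodeSolution = concatMap λ i →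
    encodePath (PathFlow.path i) ++ encodeℚ (PathFlow.amount i) ++ [ semi ]

StaticRobustMaxFlow : MaxProblem
StaticRobustMaxFlow = record { Instance = StaticInstance ; Static }

record OverTimeInstance : Set where
  field
    network : Network
  open Network network public
  field
    travelTime delay : Fin m → ℕ
    T                : ℕ
    T≥1              : 1 ≤ T
    Γ                : ℕ

record TimedPathFlow (m : ℕ) : Set where
  field
    path  : List (Fin m)
    rate  : ℚ
    begin : ℕ
    end   : ℕ

module OverTime (I : OverTimeInstance) where
  open OverTimeInstance I

  Solution : Set
  Solution = List (TimedPathFlow m)

  delayIn : Subset m → Edge → ℕ
  delayIn z e = if lookup z e then delay e else 0

  τ : List Edge → ℕ
  τ P = sum (map travelTime P)

  Δ : Subset m → List Edge → ℕ
  Δ z P = sum (map (delayIn z) P)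

  -- The time at which flow entering the path P at time 0 enters its edge e.
  arrival : Subset m → List Edge → Edge → ℕ
  arrival z P e = sum (map (λ e′ → travelTime e′ + delayIn z e′)
                           (takeWhile (λ e′ → ¬? (e′ Fin.≟ e)) P))

  record WellFormed (i : TimedPathFlow m) : Set where
    open TimedPathFlow i
    field
      simple    : SimplePath path
      positive  : 0ℚ <ℚ rate
      begin<end : begin < end
      end≤T     : end ≤ T

  module _ (S : Solution) where

    inflow : List Edge → ℚ → ℚ
    inflow P θ = ∑ (filter (λ i → (TimedPathFlow.path i ≟ₚ P) ×-dec
                                  (fromℕ (TimedPathFlow.begin i) ≤ℚ? θ) ×-dec
                                  (θ <ℚ? fromℕ (TimedPathFlow.end i))) S)
                   TimedPathFlow.rate

    -- The inflow is constant on intervals [k , k+1) with k an integer, so it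
    -- makes no difference that θ is rational rather than real.
    record Feasible : Set where
      field
        triples    : All WellFormed S
        capacities : ∀ e θ z → 0ℚ ≤ℚ θ → θ <ℚ fromℕ T → ∣ z ∣ ≤ Γ →
                     ∑ (pathsThrough e) (λ P → inflow P (θ -ℚ fromℕ (arrival z P e)))
                       ≤ℚ fromℕ (capacity e)

    -- ∫₀ᴺ inflow P ν dν: the inflow is constant on [k , k+1) for every k : ℕ,
    -- because begin and end are natural numbers.
    ∫₀ : ℕ → List Edge → ℚ
    ∫₀ N P = ∑ (upTo N) (λ k → inflow P (fromℕ k))

    value : ℚ
    value = minUpTo Γ (λ z → ∑ 𝒫 (λ P → ∫₀ (T ∸ τ P ∸ Δ z P) P))

  encodeInstance : Word
  encodeInstance =
    encodeFin source ++ encodeFin sink ++ encodeℕ Γ ++ encodeℕ T ++ semi ∷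
    concatMap encodeFin (allFin n) ++ semi ∷
    concatMap (λ e → encodeFin (tail e) ++ encodeFin (head e) ++ encodeℕ (capacity e) ++
                     encodeℕ (travelTime e) ++ encodeℕ (delay e) ++ [ semi ])
              (allFin m)

  encodeSolution : Solution → Word
  encodeSolution = concatMap λ i →
    encodePath (TimedPathFlow.path i) ++ encodeℚ (TimedPathFlow.rate i) ++
    encodeℕ (TimedPathFlow.begin i) ++ encodeℕ (TimedPathFlow.end i) ++ [ semi ]

RobustMaxFlowOverTime : MaxProblem
RobustMaxFlowOverTime = record { Instance = OverTimeInstance ; OverTime }

{-# OPTIONS --safe #-}
-- Keep the network, take T = 1, and give every edge travel time 0 and delay 1.
-- All flow is then sent during [0,1), and flow on a path arrives in time exactly
-- if none of its edges is delayed, so delays act as failures.  A delayed edge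
-- moves later inflow out of the time horizon, so only the scenario ∅ constrains
-- the capacities.  Both encodings are translated symbol by symbol by finite-state
-- transducers.
module Submission where

open import Defs

open import Data.Bool using (true; false; if_then_else_)
open import Data.Fin using (Fin; toℕ)
open import Data.Fin.Patterns
import Data.Fin.Properties as Fin
open import Data.Fin.Subset using (Subset; _∈_; _∉_) renaming (⊥ to ∅)
open import Data.Fin.Subset.Properties using (∣⊥∣≡0; ∉⊥) renaming (_∈?_ to _∈ₛ?_)
import Data.Integer as ℤ
open import Data.List using (List; []; _∷_; [_]; _++_; map; concatMap; length; allFin; filter; foldr;
  takeWhile; _ʳ++_)
import Data.List.Extrema as Extrema
open import Data.List.Properties using (filter-none; map-cong; map-∘; map-id; reverse-involutive)
open import Data.List.Relation.Unary.All as All using (All; []; _∷_)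
import Data.List.Relation.Unary.All.Properties as All
open import Data.Maybe using (Maybe; just; nothing)
open import Data.Nat using (ℕ; zero; suc; _+_; _∸_; _*_; _^_; _≤_; _<_; z≤n; s≤s)
open import Data.Nat.ListAction using (sum)
open import Data.Nat.Properties
open import Data.Product using (Σ; ∃-syntax; _×_; _,_; proj₁; proj₂)
open import Data.Rational using (ℚ; 0ℚ; 1ℚ; ↥_; ↧ₙ_; *<*) renaming (_+_ to _+ℚ_; _-_ to _-ℚ_;
  -_ to -ℚ_; _≤_ to _≤ℚ_; _<_ to _<ℚ_; _≤?_ to _≤ℚ?_; _<?_ to _<ℚ?_)
import Data.Rational.Properties as ℚ
import Data.Rational.Unnormalised as ℚᵘ
import Data.Rational.Unnormalised.Properties as ℚᵘ
open import Data.Vec as Vec using (Vec; []; _∷_; lookup)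
open import Data.Vec.Properties using (lookup⇒[]=; []=⇒lookup)
open import Function using (_⇔_; mk⇔; Equivalence; _∘_)
open import Relation.Binary.Bundles using (DecTotalOrder)
open import Relation.Binary.PropositionalEquality using (_≡_; refl; cong; cong₂; trans; subst; subst₂)
  renaming (sym to ≡-sym)
open import Relation.Nullary using (yes; no; ¬_; ¬?; contradiction)
open import Relation.Unary using (Decidable)

-- Finite-state transducers and their simulation by two-tape machines.

data Instruction (Q : Set) : Set where
  keep delete : Q → Instruction Q
  insert      : Sym → Q → Instruction Q

Transducer : ℕ → Set
Transducer k = Fin k → Sym → Instruction (Fin k)

module _ {k : ℕ} (σ : Transducer k) where

  data Run : Fin k → Word → Word → Fin k → Set where
    done   : ∀ {q} → Run q [] [] q
    keep   : ∀ {q q₁ q₂ x u v} → σ q x ≡ keep q₁ →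
             Run q₁ u v q₂ → Run q (x ∷ u) (x ∷ v) q₂
    delete : ∀ {q q₁ q₂ x u v} → σ q x ≡ delete q₁ →
             Run q₁ u v q₂ → Run q (x ∷ u) v q₂
    -- Insertions raise the state, so fewer than k of them precede the
    -- consumption of a symbol; this is what bounds the running time.
    insert : ∀ {q q₁ q₂ x y u v} → σ q x ≡ insert y q₁ → toℕ q < toℕ q₁ →
             Run q₁ (x ∷ u) v q₂ → Run q (x ∷ u) (y ∷ v) q₂

module _ {k : ℕ} {σ : Transducer k} where

  infixr 5 _⊙_

  _⊙_ : ∀ {q q₁ q₂ u u′ v v′} → Run σ q u v q₁ → Run σ q₁ u′ v′ q₂ →
        Run σ q (u ++ u′) (v ++ v′) q₂
  done         ⊙ r′ = r′
  keep e r     ⊙ r′ = keep e (r ⊙ r′)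
  delete e r   ⊙ r′ = delete e (r ⊙ r′)
  insert e l r ⊙ r′ = insert e l (r ⊙ r′)

  keepAll : ∀ {q u} → All (λ x → σ q x ≡ keep q) u → Run σ q u u q
  keepAll []       = done
  keepAll (e ∷ es) = keep e (keepAll es)

  deleteAll : ∀ {q u} → All (λ x → σ q x ≡ delete q) u → Run σ q u [] q
  deleteAll []       = done
  deleteAll (e ∷ es) = delete e (deleteAll es)

  run-concatMap : ∀ {A : Set} {q} {h h′ : A → Word} → (∀ a → Run σ q (h a) (h′ a) q) →
                  ∀ as → Run σ q (concatMap h as) (concatMap h′ as) q
  run-concatMap r []       = done
  run-concatMap r (a ∷ as) = r a ⊙ run-concatMap r as

module _ {k : ℕ} (σ : Transducer k) where

  -- The output head always rests on the blank just after the output, so a deletion rewrites that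
  -- blank and stays. An insertion holds the input head still, so the same symbol is read again in
  -- the new state.
  act : Sym → Instruction (Fin k) → Fin k × Vec (TapeSym 0 × Move) 2
  act x (keep q)     = q , (sym x , right) ∷ (sym x , right) ∷ []
  act x (delete q)   = q , (sym x , right) ∷ (blank , stay)  ∷ []
  act x (insert y q) = q , (sym x , stay)  ∷ (sym y , right) ∷ []

  transition : Fin k → Vec (TapeSym 0) 2 → Maybe (Fin k × Vec (TapeSym 0 × Move) 2)
  transition q (blank ∷ _) = nothing
  transition q (sym x ∷ _) = just (act x (σ q x))

  transducerMachine : Fin k → Machine
  transducerMachine q₀ = record
    { states = k ; auxSyms = 0 ; workTapes = 0 ; start = q₀ ; δ = transition }

  inputTape : List (TapeSym 0) → Word → Tape 0
  inputTape ls []      = tape ls blank []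
  inputTape ls (x ∷ u) = tape ls (sym x) (map sym u)

  move-right : ∀ ls x u → move right (inputTape ls (x ∷ u)) ≡ inputTape (sym x ∷ ls) u
  move-right ls x []      = refl
  move-right ls x (y ∷ u) = refl

  wordTape≡inputTape : ∀ u → wordTape u ≡ inputTape [] u
  wordTape≡inputTape []      = refl
  wordTape≡inputTape (x ∷ u) = refl

  module _ (q₀ : Fin k) where

    private M = transducerMachine q₀

    config : Fin k → List (TapeSym 0) → Word → List (TapeSym 0) → Config M
    config q ls u os = q , inputTape ls u ∷ tape os blank [] ∷ []

    -- An amortised time bound with the state index as potential. An insertion takes one step and
    -- raises the index. A consumed symbol is credited with `k`, which pays for its step and for any
    -- drop of the index, since indices are below `k`. Cells left of the output head are listed in
    -- reverse, hence `ʳ++`.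
    HaltsFrom : Fin k → List (TapeSym 0) → Word → List (TapeSym 0) → Word → Fin k → Set
    HaltsFrom q ls u os v q′ =
      ∃[ t ] ∃[ ls′ ] t + toℕ q ≤ k * length u + toℕ q′ ×
        _⇓[_]_ M (config q ls u os) t (config q′ ls′ [] (map sym v ʳ++ os))

    -- At `σ q x` this is what `step` computes to. With the instruction as a separate argument, the
    -- equation stored in a `Run` constructor applies by congruence.
    perform : Sym → List (TapeSym 0) → Word → List (TapeSym 0) → Instruction (Fin k) → Config M
    perform x ls u os i =
      proj₁ (act x i) , Vec.zipWith write (proj₂ (act x i)) (proj₂ (config (proj₁ (act x i)) ls (x ∷ u) os))

    consume-time : ∀ {t l b} (q q₁ : Fin k) → t + toℕ q₁ ≤ k * l + b →
                   suc t + toℕ q ≤ k * suc l + b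
    consume-time {t} {l} {b} q q₁ le = begin
      suc t + toℕ q      ≡⟨ +-suc t (toℕ q) ⟨
      t + suc (toℕ q)    ≤⟨ +-monoʳ-≤ t (Fin.toℕ<n q) ⟩
      t + k              ≤⟨ +-monoˡ-≤ k (≤-trans (m≤m+n t (toℕ q₁)) le) ⟩
      k * l + b + k      ≡⟨ +-comm (k * l + b) k ⟩
      k + (k * l + b)    ≡⟨ +-assoc k (k * l) b ⟨
      k + k * l + b      ≡⟨ cong (_+ b) (*-suc k l) ⟨
      k * suc l + b      ∎
      where open ≤-Reasoning

    run⇒halts : ∀ {q u v q′} → Run σ q u v q′ → ∀ ls os → HaltsFrom q ls u os v q′
    run⇒halts {q} done ls os =
      0 , ls , m≤n+m (toℕ q) (k * 0) , halt refl
    run⇒halts {q} (keep {q₁ = q₁} {x = x} {u = u} e r) ls os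
      with t , ls′ , le , h ← run⇒halts r (sym x ∷ ls) (sym x ∷ os)
      = suc t , ls′ , consume-time q q₁ le ,
        next (cong just (trans (cong (perform x ls u os) e) (cong (λ i → _ , i ∷ _) (move-right ls x u)))) h
    run⇒halts {q} (delete {q₁ = q₁} {x = x} {u = u} e r) ls os
      with t , ls′ , le , h ← run⇒halts r (sym x ∷ ls) os
      = suc t , ls′ , consume-time q q₁ le ,
        next (cong just (trans (cong (perform x ls u os) e) (cong (λ i → _ , i ∷ _) (move-right ls x u)))) h
    run⇒halts {q} (insert {x = x} {y = y} {u = u} e l r) ls os
      with t , ls′ , le , h ← run⇒halts r ls (sym y ∷ os)
      = suc t , ls′ , ≤-trans (≤-reflexive (≡-sym (+-suc t (toℕ q)))) (≤-trans (+-monoʳ-≤ t l) le) ,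
        next (cong just (cong (perform x ls u os) e)) h

    run⇒outputs : ∀ {u v q′} → Run σ q₀ u v q′ →
                  ∃[ t ] t ≤ k * length u ^ 1 + k × OutputsIn M t u v
    run⇒outputs {u} {v} {q′} r with t , ls , le , h ← run⇒halts r [] []
      = t , time , _ ,
        subst (λ i → _⇓[_]_ M (q₀ , i ∷ _) t (config q′ ls [] (map sym v ʳ++ []))) (≡-sym (wordTape≡inputTape u)) h ,
        -- No blank precedes the output; the one that follows is the cell under the head.
        0 , 1 , cong (_++ [ blank ]) (reverse-involutive (map sym v))
      where
      open ≤-Reasoning
      time : t ≤ k * length u ^ 1 + k
      time = begin
        t                      ≤⟨ m≤m+n t (toℕ q₀) ⟩
        t + toℕ q₀             ≤⟨ le ⟩
        k * length u + toℕ q′  ≤⟨ +-monoʳ-≤ (k * length u) (Fin.toℕ≤n q′) ⟩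
        k * length u + k       ≡⟨ cong (λ l → k * l + k) (*-identityʳ (length u)) ⟨
        k * length u ^ 1 + k   ∎

run⇒polytime : ∀ {k} {X : Set} {input output : X → Word} (σ : Transducer k) (q₀ : Fin k) {q : X → Fin k} →
               (∀ x → Run σ q₀ (input x) (output x) (q x)) → PolyTime input output
run⇒polytime {k} σ q₀ r = record
  { machine = transducerMachine σ q₀ ; c = k ; k = 1 ; computes = λ x → run⇒outputs σ q₀ (r x) }

-- The two maps of the reduction as transductions.

overTime : StaticInstance → OverTimeInstance
overTime I = record
  { network = network ; travelTime = λ _ → 0 ; delay = λ _ → 1 ; T = 1 ; T≥1 = ≤-refl ; Γ = Γ }
  where open StaticInstance I

forget : ∀ {m} → TimedPathFlow m → PathFlow m
forget i = record { path = path ; amount = rate } where open TimedPathFlow i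

module _ {P : Sym → Set} (bits : ∀ b → P (bit b)) (comma! : P comma) where

  -- A state that treats bits and commas uniformly can thus pass over a number without any analysis
  -- of its digits.
  all-encodeℕ : ∀ k → All P (encodeℕ k)
  all-encodeℕ k = All.++⁺ (All.map⁺ (All.universal bits _)) (comma! ∷ [])

  all-encodeFins : ∀ {n} (is : List (Fin n)) → All P (concatMap encodeFin is)
  all-encodeFins is = All.concat⁺ (All.map⁺ (All.universal (λ i → all-encodeℕ (toℕ i)) is))

-- T = 1 is inserted before the first semicolon and the pair 0, 1 (travel time,
-- delay) before every semicolon from the third on.
insertTimes : Transducer 9
insertTimes 0F semi = insert (bit 1F) 1F
insertTimes 1F _    = insert comma 2F
insertTimes 2F _    = keep 3F
insertTimes 3F semi = keep 4F
insertTimes 4F semi = insert (bit 0F) 5F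
insertTimes 5F _    = insert comma 6F
insertTimes 6F _    = insert (bit 1F) 7F
insertTimes 7F _    = insert comma 8F
insertTimes 8F _    = keep 4F
insertTimes q  _    = keep q

overTime-polytime : PolyTime Static.encodeInstance (λ I → OverTime.encodeInstance (overTime I))
overTime-polytime = run⇒polytime insertTimes 0F {q = λ _ → 4F} run
  where
  run : ∀ I → Run insertTimes 0F (Static.encodeInstance I) (OverTime.encodeInstance (overTime I)) 4F
  run I =
    number source ⊙ number sink ⊙ keepAll (all-encodeℕ (λ _ → refl) refl Γ) ⊙
    -- The two insertions spell `encodeℕ 1`, the horizon, while the first semicolon waits to be
    -- consumed.
    insert refl ≤-refl (insert refl ≤-refl (keep refl
      (keepAll (all-encodeFins (λ _ → refl) refl (allFin n)) ⊙
       keep refl (run-concatMap edge (allFin m)))))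
    where
    open StaticInstance I
    number : (v : Fin n) → Run insertTimes 0F (encodeFin v) (encodeFin v) 0F
    number v = keepAll (all-encodeℕ (λ _ → refl) refl (toℕ v))
    edge : ∀ e → Run insertTimes 4F
                   (encodeFin (tail e) ++ encodeFin (head e) ++ encodeℕ (capacity e) ++ [ semi ])
                   (encodeFin (tail e) ++ encodeFin (head e) ++ encodeℕ (capacity e) ++
                     encodeℕ 0 ++ encodeℕ 1 ++ [ semi ]) 4F
    edge e =
      copy (toℕ (tail e)) ⊙ copy (toℕ (head e)) ⊙ copy (capacity e) ⊙
      -- The four insertions spell `encodeℕ 0 ++ encodeℕ 1` in ascending states; only consuming the
      -- semicolon lowers the state back to `4F`.
      insert refl ≤-refl (insert refl ≤-refl (insert refl ≤-refl (insert refl ≤-refl (keep refl done))))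
      where
      copy : ∀ k → Run insertTimes 4F (encodeℕ k) (encodeℕ k) 4F
      copy k = keepAll (all-encodeℕ (λ _ → refl) refl k)

-- State 0 skips the instance, 1 copies a path, 2 and 3 copy the two parts of
-- the rate, and 4 skips begin and end.
dropTimes : Transducer 5
dropTimes 0F pairSep = delete 1F
dropTimes 0F _       = delete 0F
dropTimes 1F bar     = keep 2F
dropTimes 2F comma   = keep 3F
dropTimes 3F comma   = keep 4F
dropTimes 4F semi    = keep 1F
dropTimes 4F _       = delete 4F
dropTimes q  _       = keep q

forget-polytime : PolyTime {Σ StaticInstance (λ I → OverTime.Solution (overTime I))}
  (λ (I , S) → Static.encodeInstance I ++ pairSep ∷ OverTime.encodeSolution (overTime I) S)
  (λ (I , S) → Static.encodeSolution I (map forget S))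
forget-polytime = run⇒polytime dropTimes 0F {q = λ _ → 1F} run
  where
  number : ∀ {q q′} → (∀ b → dropTimes q (bit b) ≡ keep q) → dropTimes q comma ≡ keep q′ →
           ∀ k → Run dropTimes q (encodeℕ k) (encodeℕ k) q′
  number b c k = keepAll (All.map⁺ (All.universal b _)) ⊙ keep c done

  numerator : ∀ p → Run dropTimes 2F (encodeℤ p) (encodeℤ p) 3F
  numerator (ℤ.+ k)    = number (λ _ → refl) refl k
  numerator ℤ.-[1+ k ] = keep refl (number (λ _ → refl) refl (suc k))

  skip : ∀ k → Run dropTimes 4F (encodeℕ k) [] 4F
  skip k = deleteAll (all-encodeℕ (λ _ → refl) refl k)

  run : ∀ ((I , S) : Σ StaticInstance (λ I → OverTime.Solution (overTime I))) → Run dropTimes 0F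
    (Static.encodeInstance I ++ pairSep ∷ OverTime.encodeSolution (overTime I) S)
    (Static.encodeSolution I (map forget S)) 1F
  -- An instance contains no `pairSep`, so state `0F` is left exactly where the solution begins.
  run (I , S) = deleteAll skipped ⊙ delete refl (entries S)
    where
    open StaticInstance I
    num : ∀ k → All (λ x → dropTimes 0F x ≡ delete 0F) (encodeℕ k)
    num = all-encodeℕ (λ _ → refl) refl
    skipped : All (λ x → dropTimes 0F x ≡ delete 0F) (Static.encodeInstance I)
    skipped = All.++⁺ (num (toℕ source)) (All.++⁺ (num (toℕ sink)) (All.++⁺ (num Γ) (refl ∷
      All.++⁺ (all-encodeFins (λ _ → refl) refl (allFin n)) (refl ∷
      All.concat⁺ (All.map⁺ (All.universal (λ e → All.++⁺ (num (toℕ (tail e)))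
        (All.++⁺ (num (toℕ (head e))) (All.++⁺ (num (capacity e)) (refl ∷ [])))) (allFin m)))))))
    entries : ∀ S → Run dropTimes 1F (OverTime.encodeSolution (overTime I) S)
                                    (Static.encodeSolution I (map forget S)) 1F
    entries []      = done
    entries (i ∷ S) =
      ((keepAll (all-encodeFins (λ _ → refl) refl path) ⊙ keep refl done) ⊙
       (numerator (↥ rate) ⊙ number (λ _ → refl) refl (↧ₙ rate)) ⊙
       skip begin ⊙ skip end ⊙ keep refl done) ⊙ entries S
      where open TimedPathFlow i

-- Sums over filtered lists, minima and rational estimates.

module _ {A : Set} where

  ∑-cong : ∀ {h h′ : A → ℚ} → (∀ a → h a ≡ h′ a) → ∀ as → ∑ as h ≡ ∑ as h′
  ∑-cong eq as = cong (foldr _+ℚ_ 0ℚ) (map-cong eq as)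

  ∑-mono : ∀ {h h′ : A → ℚ} → (∀ a → h a ≤ℚ h′ a) → ∀ as → ∑ as h ≤ℚ ∑ as h′
  ∑-mono le []       = ℚ.≤-refl
  ∑-mono le (a ∷ as) = ℚ.+-mono-≤ (le a) (∑-mono le as)

  ∑-nonneg : ∀ {h : A → ℚ} {as} → All (λ a → 0ℚ ≤ℚ h a) as → 0ℚ ≤ℚ ∑ as h
  ∑-nonneg []         = ℚ.≤-refl
  ∑-nonneg (le ∷ les) = ℚ.+-mono-≤ le (∑-nonneg les)

  -- For comparing the objectives: one sums over all paths, with zero contributions from those that
  -- fail, the other over surviving paths only.
  ∑-filter : ∀ {P : A → Set} (P? : Decidable P) {h h′ : A → ℚ} →
             (∀ a → P a → h a ≡ h′ a) → (∀ a → ¬ P a → h a ≡ 0ℚ) →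
             ∀ as → ∑ as h ≡ ∑ (filter P? as) h′
  ∑-filter P? eq eq₀ []       = refl
  ∑-filter P? eq eq₀ (a ∷ as) with P? a
  ... | yes p = cong₂ _+ℚ_ (eq a p) (∑-filter P? eq eq₀ as)
  ... | no ¬p = trans (cong₂ _+ℚ_ (eq₀ a ¬p) (∑-filter P? eq eq₀ as)) (ℚ.+-identityˡ _)

  sum≡0 : ∀ {h : A → ℕ} {as} → All (λ a → h a ≡ 0) as → sum (map h as) ≡ 0
  sum≡0 []         = refl
  sum≡0 (eq ∷ eqs) = cong₂ _+_ eq (sum≡0 eqs)

-- The equivalence is asked only of the entries of `as`: the time window test and the plain path
-- test agree on well-formed triples, not on arbitrary ones.
∑-filter-map : ∀ {A B : Set} {P : A → Set} {Q : B → Set} (P? : Decidable P) (Q? : Decidable Q)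
               {f : A → B} {h : B → ℚ} {as} → All (λ a → P a ⇔ Q (f a)) as →
               ∑ (filter P? as) (h ∘ f) ≡ ∑ (filter Q? (map f as)) h
∑-filter-map P? Q? [] = refl
∑-filter-map P? Q? {f} {h} {a ∷ as} (p⇔q ∷ es) with P? a | Q? (f a)
... | yes _ | yes _ = cong (h (f a) +ℚ_) (∑-filter-map P? Q? es)
... | yes p | no ¬q = contradiction (Equivalence.to p⇔q p) ¬q
... | no ¬p | yes q = contradiction (Equivalence.from p⇔q q) ¬p
... | no _  | no _  = ∑-filter-map P? Q? es

∑-filter-support : ∀ {A : Set} {P Q : A → Set} (P? : Decidable P) (Q? : Decidable Q) {h : A → ℚ} {as} →
                   All (λ a → ¬ Q a → h a ≡ 0ℚ) as →
                   ∑ (filter P? (filter Q? as)) h ≡ ∑ (filter P? as) h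
∑-filter-support P? Q? [] = refl
∑-filter-support P? Q? {h} {a ∷ as} (eq₀ ∷ eqs) with Q? a
∑-filter-support P? Q? {h} {a ∷ as} (eq₀ ∷ eqs) | yes _ with P? a
... | yes _ = cong (h a +ℚ_) (∑-filter-support P? Q? eqs)
... | no _  = ∑-filter-support P? Q? eqs
∑-filter-support P? Q? {h} {a ∷ as} (eq₀ ∷ eqs) | no ¬q with P? a
... | yes _ = trans (∑-filter-support P? Q? eqs)
                (trans (≡-sym (ℚ.+-identityˡ _)) (cong (_+ℚ ∑ (filter P? as) h) (≡-sym (eq₀ ¬q))))
... | no _  = ∑-filter-support P? Q? eqs

minUpTo-cong : ∀ {m} Γ {h h′ : Subset m → ℚ} → (∀ F → h F ≡ h′ F) → minUpTo Γ h ≡ minUpTo Γ h′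
minUpTo-cong {m} Γ eq = cong₂ (Extrema.min (DecTotalOrder.totalOrder ℚ.≤-decTotalOrder))
                              (eq ∅) (map-cong eq (subsetsUpTo m Γ))

-- `fromℕ` normalises by a gcd that does not compute for a variable `a`, so the comparison is made
-- between unnormalised fractions.
fromℕ-suc≥1 : ∀ a → 1ℚ ≤ℚ fromℕ (suc a)
fromℕ-suc≥1 a = ℚ.toℚᵘ-cancel-≤ (ℚᵘ.≤-respʳ-≃ (ℚᵘ.≃-sym (ℚ.toℚᵘ-fromℚᵘ (ℚᵘ.mkℚᵘ (ℤ.+ suc a) 0)))
  (ℚᵘ.*≤* (ℤ.+≤+ (s≤s z≤n))))

θ-suc<0 : ∀ {θ} a → θ <ℚ 1ℚ → θ -ℚ fromℕ (suc a) <ℚ 0ℚ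
θ-suc<0 {θ} a θ<1 = subst (θ -ℚ fromℕ (suc a) <ℚ_) (ℚ.+-inverseʳ (fromℕ (suc a)))
  (ℚ.+-monoˡ-< (-ℚ fromℕ (suc a)) (ℚ.<-≤-trans θ<1 (fromℕ-suc≥1 a)))

-- Correspondence between over-time and static solutions.

module _ (I : StaticInstance) where
  private
    module A = Static I
    module B = OverTime (overTime I)
  open StaticInstance I

  begin≡0 : ∀ {i} → B.WellFormed i → TimedPathFlow.begin i ≡ 0
  begin≡0 wf = n<1⇒n≡0 (<-≤-trans begin<end end≤T) where open B.WellFormed wf

  end≡1 : ∀ {i} → B.WellFormed i → TimedPathFlow.end i ≡ 1
  end≡1 wf = ≤-antisym end≤T (≤-trans (s≤s z≤n) begin<end) where open B.WellFormed wf

  -- Integer endpoints within horizon 1 force every window to be [0,1), so the time tests always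
  -- succeed and only the path test remains.
  inflow-inside : ∀ {S θ} → All B.WellFormed S → 0ℚ ≤ℚ θ → θ <ℚ 1ℚ →
                  ∀ P → B.inflow S P θ ≡ A.x (map forget S) P
  inflow-inside {θ = θ} wfs 0≤θ θ<1 P = ∑-filter-map _ (λ i → PathFlow.path i ≟ₚ P) (All.map
    (λ wf → mk⇔ proj₁ λ eq →
      eq , subst (λ t → fromℕ t ≤ℚ θ) (≡-sym (begin≡0 wf)) 0≤θ , subst (λ t → θ <ℚ fromℕ t) (≡-sym (end≡1 wf)) θ<1)
    wfs)

  inflow-before : ∀ {S θ} → All B.WellFormed S → θ <ℚ 0ℚ → ∀ P → B.inflow S P θ ≡ 0ℚ
  inflow-before wfs θ<0 P = cong (λ S′ → ∑ S′ TimedPathFlow.rate) (filter-none _ (All.map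
    (λ wf (_ , begin≤θ , _) → ℚ.<-irrefl refl (ℚ.≤-<-trans (subst (λ t → fromℕ t ≤ℚ _) (begin≡0 wf) begin≤θ) θ<0)) wfs))

  Entry : PathFlow m → Set
  Entry i = SimplePath (PathFlow.path i) × 0ℚ ≤ℚ PathFlow.amount i

  forget-entries : ∀ {S} → All B.WellFormed S → All Entry (map forget S)
  forget-entries wfs =
    All.map⁺ (All.map (λ wf → B.WellFormed.simple wf , ℚ.<⇒≤ (B.WellFormed.positive wf)) wfs)

  x-nonneg : ∀ {S} → All B.WellFormed S → ∀ P → 0ℚ ≤ℚ A.x (map forget S) P
  x-nonneg {S} wfs P = ∑-nonneg (All.filter⁺ (λ i → PathFlow.path i ≟ₚ P)
    (All.map proj₂ (forget-entries wfs)))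

  delayIn-∉ : ∀ {z e} → e ∉ z → B.delayIn z e ≡ 0
  delayIn-∉ {z} {e} e∉z with lookup z e in eq
  ... | true  = contradiction (lookup⇒[]= e z eq) e∉z
  ... | false = refl

  delayIn-∈ : ∀ {z e} → e ∈ z → B.delayIn z e ≡ 1
  delayIn-∈ e∈z = cong (if_then 1 else 0) ([]=⇒lookup e∈z)

  Δ-survives : ∀ {z P} → All (_∉ z) P → B.Δ z P ≡ 0
  Δ-survives p = sum≡0 (All.map delayIn-∉ p)

  Δ-hit : ∀ {z} P → ¬ All (_∉ z) P → 1 ≤ B.Δ z P
  Δ-hit []          ¬p = contradiction [] ¬p
  Δ-hit {z} (e ∷ P) ¬p with e ∈ₛ? z
  ... | yes e∈z = ≤-trans (≤-reflexive (≡-sym (delayIn-∈ e∈z))) (m≤m+n _ _)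
  ... | no  e∉z = ≤-trans (Δ-hit P (¬p ∘ (e∉z ∷_))) (m≤n+m _ _)

  τ≡0 : ∀ P → B.τ P ≡ 0
  τ≡0 P = sum≡0 (All.universal (λ _ → refl) P)

  arrival-∅ : ∀ P e → B.arrival ∅ P e ≡ 0
  arrival-∅ P e = sum≡0 (All.universal (λ e′ → delayIn-∉ {∅} {e′} ∉⊥) (takeWhile (λ e′ → ¬? (e′ Fin.≟ e)) P))

  0<1 : 0ℚ <ℚ 1ℚ
  0<1 = *<* (ℤ.+<+ (s≤s z≤n))

  -- The objectives agree scenario by scenario and path by path: a surviving path keeps the whole
  -- unit horizon, while a single delayed edge truncates it to 0 and leaves an empty integral.
  value≡ : ∀ {S} → All B.WellFormed S → B.value S ≡ A.value (map forget S)
  value≡ {S} wfs = minUpTo-cong Γ λ z → ∑-filter (A.survives? z)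
    (λ P p → trans (cong (λ N → B.∫₀ S N P) (cong₂ (λ a b → 1 ∸ a ∸ b) (τ≡0 P) (Δ-survives p)))
               -- The integral over the unit horizon is the one-term sum of the inflow at time 0.
               (trans (ℚ.+-identityʳ _) (inflow-inside wfs ℚ.≤-refl 0<1 P)))
    (λ P ¬p → cong (λ N → B.∫₀ S N P)
               (trans (cong (λ a → 1 ∸ a ∸ B.Δ z P) (τ≡0 P)) (m≤n⇒m∸n≡0 (Δ-hit P ¬p))))
    𝒫

  feasible⁺ : ∀ {S} → B.Feasible S → A.Feasible (map forget S)
  feasible⁺ {S} feas = record
    { entries    = forget-entries triples
    ; capacities = λ e → subst (_≤ℚ fromℕ (capacity e))
        (∑-cong (λ P → trans (cong (λ t → B.inflow S P (0ℚ -ℚ fromℕ t)) (arrival-∅ P e))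
                             (inflow-inside triples ℚ.≤-refl 0<1 P)) (pathsThrough e))
        -- Time 0 in the scenario `∅`, admissible for every `Γ`, already yields the static
        -- constraint.
        (capacities e 0ℚ ∅ ℚ.≤-refl 0<1 (≤-trans (≤-reflexive (∣⊥∣≡0 m)) z≤n))
    }
    where open B.Feasible feas

  -- Only whether the shift vanishes matters: shift 0 gives equality, and a positive shift leads to
  -- a time before 0, where nothing flows. Arrival times under a general scenario therefore never
  -- have to be computed.
  inflow-bound : ∀ {S θ} → All B.WellFormed S → 0ℚ ≤ℚ θ → θ <ℚ 1ℚ → ∀ P t →
                 B.inflow S P (θ -ℚ fromℕ t) ≤ℚ A.x (map forget S) P
  inflow-bound {S} {θ} wfs 0≤θ θ<1 P zero    = ℚ.≤-reflexive
    (trans (cong (B.inflow S P) (ℚ.+-identityʳ θ)) (inflow-inside wfs 0≤θ θ<1 P))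
  inflow-bound {S} {θ} wfs 0≤θ θ<1 P (suc t) = subst (_≤ℚ A.x (map forget S) P)
    (≡-sym (inflow-before wfs (θ-suc<0 t θ<1) P)) (x-nonneg wfs P)

  feasible⁻ : ∀ {S} → All B.WellFormed S → A.Feasible (map forget S) → B.Feasible S
  feasible⁻ wfs feas = record
    { triples    = wfs
    ; capacities = λ e θ z 0≤θ θ<1 _ → ℚ.≤-trans
        (∑-mono (λ P → inflow-bound wfs 0≤θ θ<1 P (B.arrival z P e)) (pathsThrough e))
        (A.Feasible.capacities feas e)
    }

  positive? : Decidable (λ (i : PathFlow m) → 0ℚ <ℚ PathFlow.amount i)
  positive? i = 0ℚ <ℚ? PathFlow.amount i

  timed : PathFlow m → TimedPathFlow m
  timed i = record { path = path ; rate = amount ; begin = 0 ; end = 1 } where open PathFlow i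

  -- Static amounts may be zero but rates must be positive, so zero entries are dropped first.
  schedule : A.Solution → B.Solution
  schedule X = map timed (filter positive? X)

  schedule-wellFormed : ∀ {X} → All Entry X → All B.WellFormed (schedule X)
  schedule-wellFormed {X} es = All.map⁺ (All.zipWith
    (λ ((s , _) , p) → record { simple = s ; positive = p ; begin<end = ≤-refl ; end≤T = ≤-refl })
    (All.filter⁺ positive? es , All.all-filter positive? X))

  x-schedule : ∀ {X} → All Entry X → ∀ P → A.x (map forget (schedule X)) P ≡ A.x X P
  x-schedule {X} es P = trans
    (cong (λ Y → A.x Y P) (trans (≡-sym (map-∘ (filter positive? X))) (map-id (filter positive? X))))
    (∑-filter-support (λ i → PathFlow.path i ≟ₚ P) positive?
      -- A dropped entry is not positive and, being an `Entry`, not negative; it contributes 0.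
      (All.map (λ (_ , 0≤i) i≤0 → ℚ.≤-antisym (ℚ.≮⇒≥ i≤0) 0≤i) es))

  schedule-feasible : ∀ {X} → A.Feasible X → B.Feasible (schedule X)
  schedule-feasible {X} feas = feasible⁻ wfs (record
    { entries    = forget-entries wfs
    ; capacities = λ e → subst (_≤ℚ fromℕ (capacity e))
        (∑-cong (λ P → ≡-sym (x-schedule entries P)) (pathsThrough e)) (capacities e)
    })
    where
    open A.Feasible feas
    wfs = schedule-wellFormed entries

  value-schedule : ∀ {X} → A.Feasible X → B.value (schedule X) ≡ A.value X
  value-schedule feas = trans (value≡ (schedule-wellFormed entries))
    (minUpTo-cong Γ (λ F → ∑-cong (x-schedule entries) (filter (A.survives? F) 𝒫)))
    where open A.Feasible feas

proposition2 : StaticRobustMaxFlow ≤ᵖ RobustMaxFlowOverTime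
proposition2 = record
  { f          = overTime
  ; f-polytime = overTime-polytime
  ; threshold  = λ I K → mk⇔
      (λ (X , feas , K≤) → schedule I X , schedule-feasible I feas ,
        subst (K ≤ℚ_) (≡-sym (value-schedule I feas)) K≤)
      (λ (S , feas , K≤) → map forget S , feasible⁺ I feas ,
        subst (K ≤ℚ_) (value≡ I (OverTime.Feasible.triples feas)) K≤)
  ; g          = λ _ → map forget
  ; g-polytime = forget-polytime
  -- A static competitor `X` is compared through `schedule I X`, which has the same value and which
  -- the optimal `S` dominates.
  ; optimal    = λ I S (feas , best) → feasible⁺ I feas , λ X feas′ →
      subst₂ _≤ℚ_ (value-schedule I feas′) (value≡ I (OverTime.Feasible.triples feas))
        (best (schedule I X) (schedule-feasible I feas′))
  }
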